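{- Let $k\ge 0$ be an integer and let $G$ be the $(2k+1)\times(2k+1)$ grid graph. For any vertex $h$ of $G$, let $a(2k+1;h)$ denote the number of near-perfect matchings of $G$ in which $h$ is the unmatched vertex (equivalently, the number of perfect matchings of $G-h$). Then for every vertex $h$, $a(2k+1;h)$ is a multiple of $2^k$.
   Context: The $m\times n$ grid graph has vertex set $\{1,\dots,m\}\times\{1,\dots,n\}$, with two vertices adjacent when they differ by $1$ in exactly one coordinate. For a graph with an odd number of vertices, a near-perfect matching is a set of pairwise disjoint edges covering all vertices but one; the uncovered vertex is called the hole. -}

module Defs where

open import Data.Nat using (ℕ; zero; suc; _≟_)
open import Data.Fin using (Fin; inject₁) renaming (suc to fsuc)
import Data.Fin.Properties as FinP
open import Data.Product using (_×_; _,_; proj₁; proj₂)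
open import Data.Product.Properties using (≡-dec)
open import Data.List using (List; []; _∷_; _++_; map; length; filter; allFin; cartesianProduct; concatMap)
open import Data.List.Relation.Unary.All using (All; all?)
open import Data.Sum using (_⊎_)
open import Relation.Nullary using (Dec; yes; no; _⊎-dec_)
open import Relation.Binary.PropositionalEquality using (_≡_)
open import Relation.Binary.Definitions using (DecidableEquality)

-- Vertices of the n × n grid graph: {1..n} × {1..n}, coordinates shifted to Fin n = {0..n-1}.
Vertex : ℕ → Set
Vertex n = Fin n × Fin n

_≟V_ : ∀ {n} → DecidableEquality (Vertex n)
_≟V_ = ≡-dec FinP._≟_ FinP._≟_

Edge : ℕ → Set
Edge n = Vertex n × Vertex n

allVertices : (n : ℕ) → List (Vertex n)
allVertices n = cartesianProduct (allFin n) (allFin n)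

-- The edge list of the n × n grid graph, each edge listed exactly once:
-- horizontal edges (i,j)–(i,j+1) and vertical edges (i,j)–(i+1,j).
gridEdges : (n : ℕ) → List (Edge n)
gridEdges zero = []
gridEdges (suc m) =
  map (λ p → ((proj₁ p , inject₁ (proj₂ p)) , (proj₁ p , fsuc (proj₂ p))))
      (cartesianProduct (allFin (suc m)) (allFin m))
  ++
  map (λ p → ((inject₁ (proj₁ p) , proj₂ p) , (fsuc (proj₁ p) , proj₂ p)))
      (cartesianProduct (allFin m) (allFin (suc m)))

-- All sub-lists of a list (= all subsets of the edge set, edges being distinct).
sublists : ∀ {A : Set} → List A → List (List A)
sublists [] = [] ∷ []
sublists (x ∷ xs) = let r = sublists xs in r ++ map (x ∷_) r

Incident : ∀ {n} → Vertex n → Edge n → Set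
Incident v e = (v ≡ proj₁ e) ⊎ (v ≡ proj₂ e)

incident? : ∀ {n} (v : Vertex n) (e : Edge n) → Dec (Incident v e)
incident? v e = (v ≟V proj₁ e) ⊎-dec (v ≟V proj₂ e)

degree : ∀ {n} → List (Edge n) → Vertex n → ℕ
degree S v = length (filter (incident? v) S)

required : ∀ {n} → Vertex n → Vertex n → ℕ
required h v with v ≟V h
... | yes _ = 0
... | no _ = 1

IsNearPerfectMatching : ∀ {n} → Vertex n → List (Edge n) → Set
IsNearPerfectMatching {n} h S = All (λ v → degree S v ≡ required h v) (allVertices n)

isNearPerfectMatching? : ∀ {n} (h : Vertex n) (S : List (Edge n)) → Dec (IsNearPerfectMatching h S)
isNearPerfectMatching? {n} h S = all? (λ v → degree S v ≟ required h v) (allVertices n)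

a : (n : ℕ) → Vertex n → ℕ
a n h = length (filter (isNearPerfectMatching? h) (sublists (gridEdges n)))

{-# OPTIONS --safe #-}
module Submission where

open import Defs
open import Data.Nat using (ℕ; suc; _+_; _*_; _^_)
open import Data.Nat using (_∸_; _≤_; _<_; z≤n; s≤s; ⌊_/2⌋; ⌈_/2⌉)
open import Data.Nat.Divisibility using (_∣_)
open import Data.Nat.Divisibility using (∣-trans; _∣0; 1∣_; m∣m*n; *-monoʳ-∣; ∣m∣n⇒∣m+n)
import Data.Nat.Properties as ℕₚ
open import Data.Nat.Tactic.RingSolver using (solve-∀)
open import Data.Bool using (Bool; true; false; if_then_else_; _∧_; _∨_; not)
import Data.Bool.Properties as 𝔹ₚ
open import Data.Fin using (Fin; inject₁) renaming (suc to fsuc)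
import Data.Fin.Properties as Finₚ
open import Data.Product using (_×_; _,_; proj₁; proj₂; ∃) renaming (swap to ×-swap; map to ×-map)
open import Data.Sum using (_⊎_; inj₁; inj₂)
open import Data.List using (List; []; _∷_; _++_; map; length; filter; allFin; cartesianProduct)
import Data.List.Properties as Listₚ
open import Data.List.Membership.Propositional using (_∈_)
open import Data.List.Membership.Propositional.Properties using (∈-allFin; ∈-cartesianProduct⁺)
open import Data.List.Relation.Unary.Any using (here; there)
open import Data.List.Relation.Unary.All as All using (All; []; _∷_; all?)
import Data.List.Relation.Unary.All.Properties as Allₚ
open import Data.List.Relation.Unary.AllPairs using ([]; _∷_)
open import Data.List.Relation.Unary.Unique.Propositional using (Unique)
import Data.List.Relation.Unary.Unique.Propositional.Properties as Uniqueₚ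
open import Data.List.Relation.Binary.Permutation.Propositional as Perm using (_↭_; ↭-trans; ↭-sym; ↭-reflexive)
import Data.List.Relation.Binary.Permutation.Propositional.Properties as Permₚ
open import Function using (_∘_)
open import Function.Bundles using (mk⇔)
open import Relation.Nullary using (Dec; does; yes; no; ¬_; contradiction; _⊎-dec_)
open import Relation.Nullary.Decidable using (dec-true; dec-false; does-⇔)
open import Relation.Binary.Definitions using (DecidableEquality)
open import Relation.Binary.PropositionalEquality
  using (_≡_; _≢_; _≗_; refl; sym; trans; cong; cong₂; subst; module ≡-Reasoning)

-- Transposition σ is an automorphism of the grid fixing the 2k+1 diagonal
-- vertices and no edge. For a σ-invariant vertex set X with F fixed vertices,
-- 2^⌈F/2⌉ divides the number μ(X) of perfect matchings on X, and 2^⌊F/2⌋ divides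
-- μ(X ∖ u) for every u ∈ X, by simultaneous induction on |X|. For μ(X), expand
-- along the edge covering a fixed vertex v: the edges at v come in pairs {e, σe}
-- with equal contributions, so μ(X) is twice a sum of numbers μ(X ∖ v ∖ w). For
-- μ(X ∖ u) with u fixed, X ∖ u is itself σ-invariant; otherwise expand along the
-- edge covering σu: the terms are μ((X ∖ u ∖ σu) ∖ w), and X ∖ u ∖ σu is again
-- σ-invariant with F fixed vertices. The hole h of the grid is the case X =
-- everything, F = 2k+1, u = h.

-- Arithmetic and list preliminaries.

2^-mono-∣ : ∀ {m n} → m ≤ n → 2 ^ m ∣ 2 ^ n
2^-mono-∣ {m} {n} m≤n = subst (λ l → 2 ^ m ∣ 2 ^ l) (ℕₚ.m+[n∸m]≡n m≤n)
  (subst (2 ^ m ∣_) (sym (ℕₚ.^-distribˡ-+-* 2 m (n ∸ m))) (m∣m*n (2 ^ (n ∸ m))))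

+-interchange : ∀ k l m n → k + l + (m + n) ≡ k + m + (l + n)
+-interchange = solve-∀

length-filter-map : ∀ {A B : Set} {P : B → Set} (P? : ∀ y → Dec (P y)) (f : A → B) xs →
                    length (filter P? (map f xs)) ≡ length (filter (P? ∘ f) xs)
length-filter-map P? f []       = refl
length-filter-map P? f (x ∷ xs) with does (P? (f x))
... | true  = cong suc (length-filter-map P? f xs)
... | false = length-filter-map P? f xs

length-filter-[-] : ∀ {A : Set} {P : A → Set} (P? : ∀ x → Dec (P x)) x →
                    length (filter P? (x ∷ [])) ≡ (if does (P? x) then 1 else 0)
length-filter-[-] P? x with does (P? x)
... | true  = refl
... | false = refl

module MatchingCounts {V : Set} (_≟_ : DecidableEquality V)
                      (vertices : List V) (complete : ∀ v → v ∈ vertices) where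

  -- Vertex deletion and the derivative calculus.

  infixl 20 _∖_
  _∖_ : (V → Bool) → V → V → Bool
  (X ∖ u) v = X v ∧ not (does (v ≟ u))

  ∖-other : ∀ X {u v} → v ≢ u → (X ∖ u) v ≡ X v
  ∖-other X {u} {v} v≢u rewrite dec-false (v ≟ u) v≢u = 𝔹ₚ.∧-identityʳ (X v)

  ∖-cong : ∀ {X Y} u → X ≗ Y → X ∖ u ≗ Y ∖ u
  ∖-cong u X≗Y v = cong (_∧ not (does (v ≟ u))) (X≗Y v)

  ∖-comm : ∀ X u w → X ∖ u ∖ w ≗ X ∖ w ∖ u
  ∖-comm X u w v = begin
    (X v ∧ p) ∧ q ≡⟨ 𝔹ₚ.∧-assoc (X v) p q ⟩
    X v ∧ (p ∧ q) ≡⟨ cong (X v ∧_) (𝔹ₚ.∧-comm p q) ⟩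
    X v ∧ (q ∧ p) ≡⟨ 𝔹ₚ.∧-assoc (X v) q p ⟨
    (X v ∧ q) ∧ p ∎
    where
    open ≡-Reasoning
    p = not (does (v ≟ u))
    q = not (does (v ≟ w))

  -- Counts are functions of the set of vertices still to be covered; ∂ u is
  -- the partial derivative in the variable u of a multilinear polynomial.
  Functional : Set
  Functional = (V → Bool) → ℕ

  Extensional : Functional → Set
  Extensional Φ = ∀ {X Y} → X ≗ Y → Φ X ≡ Φ Y

  ∂ : V → Functional → Functional
  ∂ u Φ X = if X u then Φ (X ∖ u) else 0

  ∂-present : ∀ u Φ X → X u ≡ true → ∂ u Φ X ≡ Φ (X ∖ u)
  ∂-present u Φ X Xu rewrite Xu = refl

  ∂-absent : ∀ u Φ X → X u ≡ false → ∂ u Φ X ≡ 0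
  ∂-absent u Φ X Xu rewrite Xu = refl

  ∂-ext : ∀ u {Φ} → Extensional Φ → Extensional (∂ u Φ)
  ∂-ext u Φ-ext {X} {Y} X≗Y rewrite X≗Y u with Y u
  ... | true  = Φ-ext (∖-cong u X≗Y)
  ... | false = refl

  ∂-cong : ∀ u {Φ Ψ} → Φ ≗ Ψ → ∂ u Φ ≗ ∂ u Ψ
  ∂-cong u Φ≗Ψ X with X u
  ... | true  = Φ≗Ψ (X ∖ u)
  ... | false = refl

  -- Deleting a vertex other than `v` keeps `v` present, so agreement on the sets containing `v` is
  -- enough.
  ∂-cong-at : ∀ {u v} {Φ Ψ} → v ≢ u → (∀ X → X v ≡ true → Φ X ≡ Ψ X) →
              ∀ X → X v ≡ true → ∂ u Φ X ≡ ∂ u Ψ X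
  ∂-cong-at {u} v≢u Φ≡Ψ X Xv with X u
  ... | true  = Φ≡Ψ (X ∖ u) (trans (∖-other X v≢u) Xv)
  ... | false = refl

  ∂-+ : ∀ u Φ Ψ X → ∂ u (λ Y → Φ Y + Ψ Y) X ≡ ∂ u Φ X + ∂ u Ψ X
  ∂-+ u Φ Ψ X with X u
  ... | true  = refl
  ... | false = refl

  ∂-0 : ∀ u {Φ} → (∀ X → Φ X ≡ 0) → ∀ X → ∂ u Φ X ≡ 0
  ∂-0 u Φ≡0 X with X u
  ... | true  = Φ≡0 (X ∖ u)
  ... | false = refl

  -- After the first deletion `u` is absent. This is the algebraic form of the rule that no vertex
  -- is covered twice.
  ∂-square : ∀ u Φ X → ∂ u (∂ u Φ) X ≡ 0
  ∂-square u Φ X with X u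
  ... | true  = cong (λ b → if not b then Φ (X ∖ u ∖ u) else 0) (dec-true (u ≟ u) refl)
  ... | false = refl

  ∂-comm : ∀ u w {Φ} → Extensional Φ → ∂ u (∂ w Φ) ≗ ∂ w (∂ u Φ)
  ∂-comm u w {Φ} Φ-ext X = by-cases (u ≟ w)
    where
    by-cases : Dec (u ≡ w) → ∂ u (∂ w Φ) X ≡ ∂ w (∂ u Φ) X
    by-cases (yes refl) = refl
    by-cases (no u≢w)
      rewrite dec-false (u ≟ w) u≢w | dec-false (w ≟ u) (u≢w ∘ sym)
      with X u | X w
    ... | true  | true  = Φ-ext (∖-comm X u w)
    ... | true  | false = refl
    ... | false | true  = refl
    ... | false | false = refl

  ∂ᵉ : V × V → Functional → Functional
  ∂ᵉ (a , b) Φ = ∂ a (∂ b Φ)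

  ∂ᵉ-ext : ∀ e {Φ} → Extensional Φ → Extensional (∂ᵉ e Φ)
  ∂ᵉ-ext (a , b) Φ-ext = ∂-ext a (∂-ext b Φ-ext)

  ∂ᵉ-cong : ∀ e {Φ Ψ} → Φ ≗ Ψ → ∂ᵉ e Φ ≗ ∂ᵉ e Ψ
  ∂ᵉ-cong (a , b) Φ≗Ψ = ∂-cong a (∂-cong b Φ≗Ψ)

  ∂ᵉ-+ : ∀ e Φ Ψ X → ∂ᵉ e (λ Y → Φ Y + Ψ Y) X ≡ ∂ᵉ e Φ X + ∂ᵉ e Ψ X
  ∂ᵉ-+ (a , b) Φ Ψ X =
    trans (∂-cong a (∂-+ b Φ Ψ) X) (∂-+ a (∂ b Φ) (∂ b Ψ) X)

  ∂-∂ᵉ-comm : ∀ u e {Φ} → Extensional Φ → ∂ u (∂ᵉ e Φ) ≗ ∂ᵉ e (∂ u Φ)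
  ∂-∂ᵉ-comm u (a , b) Φ-ext X =
    trans (∂-comm u a (∂-ext b Φ-ext) X) (∂-cong a (∂-comm u b Φ-ext) X)

  ∂ᵉ-comm : ∀ e f {Φ} → Extensional Φ → ∂ᵉ e (∂ᵉ f Φ) ≗ ∂ᵉ f (∂ᵉ e Φ)
  ∂ᵉ-comm (a , b) f Φ-ext X =
    trans (∂-cong a (∂-∂ᵉ-comm b f Φ-ext) X) (∂-∂ᵉ-comm a f (∂-ext b Φ-ext) X)

  incident : V → V × V → Bool
  incident v (a , b) = does (v ≟ a) ∨ does (v ≟ b)

  -- The witness `w` is the other end of `e`. It is chosen before `Φ`, so one `w` serves every
  -- functional.
  ∂ᵉ-incident : ∀ v e → incident v e ≡ true →
                ∃ λ w → ∀ {Φ} → Extensional Φ → ∂ᵉ e Φ ≗ ∂ v (∂ w Φ)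
  ∂ᵉ-incident v (a , b) inc with v ≟ a | v ≟ b
  ... | yes refl | _        = b , λ _ _ → refl
  ... | no _     | yes refl = a , λ Φ-ext → ∂-comm a v Φ-ext
  ∂ᵉ-incident v (a , b) () | no _ | no _

  -- Both edges contain a factor `∂ v`; commutation brings the two factors together and `∂-square`
  -- applies.
  ∂ᵉ-∂ᵉ-incident : ∀ v e f {Φ} → incident v e ≡ true → incident v f ≡ true →
                   Extensional Φ → ∀ X → ∂ᵉ e (∂ᵉ f Φ) X ≡ 0
  ∂ᵉ-∂ᵉ-incident v e f {Φ} v∈e v∈f Φ-ext X
    with w , e≗ ← ∂ᵉ-incident v e v∈e | x , f≗ ← ∂ᵉ-incident v f v∈f = begin
    ∂ᵉ e (∂ᵉ f Φ) X           ≡⟨ ∂ᵉ-cong e (f≗ Φ-ext) X ⟩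
    ∂ᵉ e (∂ v (∂ x Φ)) X      ≡⟨ ∂-∂ᵉ-comm v e (∂-ext x Φ-ext) X ⟨
    ∂ v (∂ᵉ e (∂ x Φ)) X      ≡⟨ ∂-cong v (e≗ (∂-ext x Φ-ext)) X ⟩
    ∂ v (∂ v (∂ w (∂ x Φ))) X ≡⟨ ∂-square v (∂ w (∂ x Φ)) X ⟩
    0                         ∎
    where open ≡-Reasoning

  -- Matching numbers by recursion on the edge list.

  empty? : (X : V → Bool) → Dec (All (λ v → X v ≡ false) vertices)
  empty? X = all? (λ v → X v 𝔹ₚ.≟ false) vertices

  -- The product of the operators `1 + ∂ᵉ e` applied to the indicator of the empty set: each edge is
  -- either skipped or used.
  matchings : List (V × V) → Functional
  matchings []      X = if does (empty? X) then 1 else 0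
  matchings (e ∷ E) X = matchings E X + ∂ᵉ e (matchings E) X

  matchings-ext : ∀ E → Extensional (matchings E)
  matchings-ext []      {X} {Y} X≗Y = cong (λ b → if b then 1 else 0)
    (does-⇔ (mk⇔ (All.map (λ {v} → trans (sym (X≗Y v)))) (All.map (λ {v} → trans (X≗Y v))))
             (empty? X) (empty? Y))
  matchings-ext (e ∷ E) X≗Y =
    cong₂ _+_ (matchings-ext E X≗Y) (∂ᵉ-ext e (matchings-ext E) X≗Y)

  matchings-∷ : ∀ e E F → matchings E ≗ matchings F → matchings (e ∷ E) ≗ matchings (e ∷ F)
  matchings-∷ e E F E≗F X = cong₂ _+_ (E≗F X) (∂ᵉ-cong e E≗F X)

  -- The operators `1 + ∂ᵉ e` commute, so only the swap of two neighbours needs a computation.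
  matchings-↭ : ∀ {E F} → E ↭ F → matchings E ≗ matchings F
  matchings-↭ Perm.refl          X = refl
  matchings-↭ (Perm.prep {xs = E} {ys = F} e p) X = matchings-∷ e E F (matchings-↭ p) X
  matchings-↭ (Perm.trans p q)   X = trans (matchings-↭ p X) (matchings-↭ q X)
  matchings-↭ (Perm.swap {xs = E} {ys = F} e f p) X = begin
    E₀ X + ∂ᵉ f E₀ X + ∂ᵉ e (λ Y → E₀ Y + ∂ᵉ f E₀ Y) X
      ≡⟨ cong (E₀ X + ∂ᵉ f E₀ X +_) (∂ᵉ-+ e E₀ (∂ᵉ f E₀) X) ⟩
    E₀ X + ∂ᵉ f E₀ X + (∂ᵉ e E₀ X + ∂ᵉ e (∂ᵉ f E₀) X)
      ≡⟨ cong (λ z → E₀ X + ∂ᵉ f E₀ X + (∂ᵉ e E₀ X + z)) (∂ᵉ-comm e f (matchings-ext E) X) ⟩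
    E₀ X + ∂ᵉ f E₀ X + (∂ᵉ e E₀ X + ∂ᵉ f (∂ᵉ e E₀) X)
      ≡⟨ +-interchange (E₀ X) (∂ᵉ f E₀ X) (∂ᵉ e E₀ X) (∂ᵉ f (∂ᵉ e E₀) X) ⟩
    E₀ X + ∂ᵉ e E₀ X + (∂ᵉ f E₀ X + ∂ᵉ f (∂ᵉ e E₀) X)
      ≡⟨ cong (E₀ X + ∂ᵉ e E₀ X +_) (∂ᵉ-+ f E₀ (∂ᵉ e E₀) X) ⟨
    matchings (f ∷ e ∷ E) X
      ≡⟨ matchings-∷ f (e ∷ E) (e ∷ F) (matchings-∷ e E F (matchings-↭ p)) X ⟩
    matchings (f ∷ e ∷ F) X ∎
    where
    open ≡-Reasoning
    E₀ = matchings E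

  -- Expansion along the edges at a vertex.

  term : V → V × V → Functional → Functional
  term v e Φ X = if incident v e then ∂ᵉ e Φ X else 0

  -- `Φ` stays fixed while the list shrinks, which makes the sum additive in the list and lets
  -- derivatives pass through it.
  expansion : V → List (V × V) → Functional → Functional
  expansion v []      Φ X = 0
  expansion v (e ∷ E) Φ X = term v e Φ X + expansion v E Φ X

  term-+ : ∀ v e Φ Ψ X → term v e (λ Y → Φ Y + Ψ Y) X ≡ term v e Φ X + term v e Ψ X
  term-+ v e Φ Ψ X with incident v e
  ... | true  = ∂ᵉ-+ e Φ Ψ X
  ... | false = refl

  ∂-term : ∀ u v e {Φ} → Extensional Φ → term v e (∂ u Φ) ≗ ∂ u (term v e Φ)
  ∂-term u v e Φ-ext X with incident v e
  ... | true  = sym (∂-∂ᵉ-comm u e Φ-ext X)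
  ... | false = sym (∂-0 u (λ _ → refl) X)

  expansion-+ : ∀ v E Φ Ψ X →
    expansion v E (λ Y → Φ Y + Ψ Y) X ≡ expansion v E Φ X + expansion v E Ψ X
  expansion-+ v []      Φ Ψ X = refl
  expansion-+ v (e ∷ E) Φ Ψ X
    rewrite term-+ v e Φ Ψ X | expansion-+ v E Φ Ψ X =
    +-interchange (term v e Φ X) (term v e Ψ X) (expansion v E Φ X) (expansion v E Ψ X)

  ∂-expansion : ∀ u v E {Φ} → Extensional Φ → expansion v E (∂ u Φ) ≗ ∂ u (expansion v E Φ)
  ∂-expansion u v []          Φ-ext X = sym (∂-0 u (λ _ → refl) X)
  ∂-expansion u v (e ∷ E) {Φ} Φ-ext X = begin
    term v e (∂ u Φ) X + expansion v E (∂ u Φ) X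
      ≡⟨ cong₂ _+_ (∂-term u v e Φ-ext X) (∂-expansion u v E Φ-ext X) ⟩
    ∂ u (term v e Φ) X + ∂ u (expansion v E Φ) X
      ≡⟨ ∂-+ u (term v e Φ) (expansion v E Φ) X ⟨
    ∂ u (expansion v (e ∷ E) Φ) X ∎
    where open ≡-Reasoning

  ∂ᵉ-expansion : ∀ e v E {Φ} → Extensional Φ → expansion v E (∂ᵉ e Φ) ≗ ∂ᵉ e (expansion v E Φ)
  ∂ᵉ-expansion (a , b) v E Φ-ext X =
    trans (∂-expansion a v E (∂-ext b Φ-ext) X) (∂-cong a (∂-expansion b v E Φ-ext) X)

  expansion-∂ᵉ-incident : ∀ v e E {Φ} → incident v e ≡ true → Extensional Φ →
                          ∀ X → expansion v E (∂ᵉ e Φ) X ≡ 0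
  expansion-∂ᵉ-incident v e []      v∈e Φ-ext X = refl
  expansion-∂ᵉ-incident v e (f ∷ E) v∈e Φ-ext X
    rewrite expansion-∂ᵉ-incident v e E v∈e Φ-ext X with incident v f in v∈f
  ... | true  = trans (ℕₚ.+-identityʳ _) (∂ᵉ-∂ᵉ-incident v f e v∈f v∈e Φ-ext X)
  ... | false = refl

  ∂ᵉ-cong-at : ∀ v e {Φ Ψ} → incident v e ≡ false → (∀ X → X v ≡ true → Φ X ≡ Ψ X) →
               ∀ X → X v ≡ true → ∂ᵉ e Φ X ≡ ∂ᵉ e Ψ X
  ∂ᵉ-cong-at v (a , b) v∉e Φ≡Ψ with v ≟ a | v ≟ b
  ... | no v≢a | no v≢b = ∂-cong-at v≢a (∂-cong-at v≢b Φ≡Ψ)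
  ∂ᵉ-cong-at v (a , b) () Φ≡Ψ | yes _ | _
  ∂ᵉ-cong-at v (a , b) () Φ≡Ψ | no _ | yes _

  -- Exactly one edge of a matching covers v.  The factor e already used cannot
  -- be used again by matchings E, because ∂ v squares to zero.
  matchings-expansion : ∀ E v X → X v ≡ true → matchings E X ≡ expansion v E (matchings E) X
  matchings-expansion []      v X Xv = cong (λ b → if b then 1 else 0) (dec-false (empty? X) nonempty)
    where
    nonempty : ¬ All (λ w → X w ≡ false) vertices
    nonempty X≡∅ with () ← trans (sym Xv) (All.lookup X≡∅ (complete v))
  matchings-expansion (e ∷ E) v X Xv
    rewrite term-+ v e (matchings E) (∂ᵉ e (matchings E)) X
          | expansion-+ v E (matchings E) (∂ᵉ e (matchings E)) X
          | sym (matchings-expansion E v X Xv)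
    with incident v e in v∈e
  ... | true
    -- If `e` covers `v`, every contribution with a second edge at `v` vanishes, `e` itself
    -- included; only `∂ᵉ e (matchings E)` is left from `e`.
    rewrite expansion-∂ᵉ-incident v e E v∈e (matchings-ext E) X
          | ∂ᵉ-∂ᵉ-incident v e e v∈e v∈e (matchings-ext E) X =
    rearrange (matchings E X) (∂ᵉ e (matchings E) X)
    where
    rearrange : ∀ k l → k + l ≡ l + 0 + (k + 0)
    rearrange = solve-∀
  ... | false = cong (matchings E X +_) (begin
    ∂ᵉ e (matchings E) X                 ≡⟨ ∂ᵉ-cong-at v e v∈e (matchings-expansion E v) X Xv ⟩
    ∂ᵉ e (expansion v E (matchings E)) X ≡⟨ ∂ᵉ-expansion e v E (matchings-ext E) X ⟨
    expansion v E (∂ᵉ e (matchings E)) X ∎)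
    where open ≡-Reasoning

  expansion-++ : ∀ v E F Φ X → expansion v (E ++ F) Φ X ≡ expansion v E Φ X + expansion v F Φ X
  expansion-++ v []      F Φ X = refl
  expansion-++ v (e ∷ E) F Φ X
    rewrite expansion-++ v E F Φ X = sym (ℕₚ.+-assoc (term v e Φ X) _ _)

  -- An edge at `v` with other end `w` contributes `∂ v (∂ w Φ)`, and all other edges contribute 0.
  expansion-∣ : ∀ {d} v E Φ X → Extensional Φ → (∀ w → d ∣ ∂ v (∂ w Φ) X) → d ∣ expansion v E Φ X
  expansion-∣ {d} v []      Φ X Φ-ext d∣ = d ∣0
  expansion-∣ {d} v (e ∷ E) Φ X Φ-ext d∣ = ∣m∣n⇒∣m+n d∣term (expansion-∣ v E Φ X Φ-ext d∣)
    where
    d∣term : d ∣ term v e Φ X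
    d∣term with incident v e in v∈e
    ... | false = d ∣0
    ... | true with w , e≗ ← ∂ᵉ-incident v e v∈e = subst (d ∣_) (sym (e≗ Φ-ext X)) (d∣ w)

  -- Agreement of the recursion with counting sublists by degrees.

  indicator : Bool → ℕ
  indicator b = if b then 1 else 0

  -- Built exactly like `incident?`, so that on the grid `degreeIn` is definitionally `degree`.
  covers? : ∀ v (e : V × V) → Dec (v ≡ proj₁ e ⊎ v ≡ proj₂ e)
  covers? v e = (v ≟ proj₁ e) ⊎-dec (v ≟ proj₂ e)

  degreeIn : List (V × V) → V → ℕ
  degreeIn S v = length (filter (covers? v) S)

  Saturates : (V → Bool) → List (V × V) → Set
  Saturates X S = All (λ v → degreeIn S v ≡ indicator (X v)) vertices

  saturates? : ∀ X S → Dec (Saturates X S)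
  saturates? X S = all? (λ v → degreeIn S v ℕₚ.≟ indicator (X v)) vertices

  count : List (List (V × V)) → Functional
  count L X = length (filter (saturates? X) L)

  count-cong : ∀ {X} {P : List (V × V) → Set} (P? : ∀ S → Dec (P S)) →
               (∀ {S} → P S → Saturates X S) → (∀ {S} → Saturates X S → P S) →
               ∀ L → length (filter P? L) ≡ count L X
  count-cong {X} P? to from L = cong length (Listₚ.filter-≐ P? (saturates? X) (to , from) L)

  degreeIn-∷ : ∀ a b S v → degreeIn ((a , b) ∷ S) v ≡
             indicator (does (v ≟ a) ∨ does (v ≟ b)) + degreeIn S v
  degreeIn-∷ a b S v with does (v ≟ a) | does (v ≟ b)
  ... | true  | _     = refl
  ... | false | true  = refl
  ... | false | false = refl

  module _ (X : V → Bool) (a b : V) (a≢b : a ≢ b) where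

    Saturates-∷-covered : ∀ {S} → Saturates X ((a , b) ∷ S) → X a ≡ true × X b ≡ true
    Saturates-∷-covered {S} sat =
      covered a (cong (_∨ does (a ≟ b)) (dec-true (a ≟ a) refl)) ,
      covered b (trans (cong (does (b ≟ a) ∨_) (dec-true (b ≟ b) refl)) (𝔹ₚ.∨-zeroʳ _))
      where
      nonzero-indicator : ∀ {k} c → suc k ≡ indicator c → c ≡ true
      nonzero-indicator true _ = refl
      covered : ∀ v → does (v ≟ a) ∨ does (v ≟ b) ≡ true → X v ≡ true
      covered v v∈e = nonzero-indicator (X v)
        (trans (cong (λ c → indicator c + degreeIn S v) (sym v∈e))
               (trans (sym (degreeIn-∷ a b S v)) (All.lookup sat (complete v))))

    module _ (Xa : X a ≡ true) (Xb : X b ≡ true) where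

      -- Splits the demanded degree into what the edge supplies and what the remaining edges must
      -- supply; cancelling the first part gives both directions below.
      residual : ∀ v → indicator (X v) ≡
                 indicator (does (v ≟ a) ∨ does (v ≟ b)) + indicator ((X ∖ a ∖ b) v)
      residual v = by-cases (v ≟ a) (v ≟ b)
        where
        by-cases : (v≟a : Dec (v ≡ a)) (v≟b : Dec (v ≡ b)) → indicator (X v) ≡
          indicator (does v≟a ∨ does v≟b) + indicator ((X v ∧ not (does v≟a)) ∧ not (does v≟b))
        by-cases (yes refl) (yes refl) = contradiction refl a≢b
        by-cases (yes refl) (no _)  rewrite Xa = refl
        by-cases (no _) (yes refl)  rewrite Xb = refl
        by-cases (no _) (no _) with X v
        ... | true  = refl
        ... | false = refl

      Saturates-∷⁻ : ∀ {S} → Saturates X ((a , b) ∷ S) → Saturates (X ∖ a ∖ b) S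
      Saturates-∷⁻ {S} = All.map λ {v} eq →
        ℕₚ.+-cancelˡ-≡ (indicator (does (v ≟ a) ∨ does (v ≟ b))) _ _
          (trans (sym (degreeIn-∷ a b S v)) (trans eq (residual v)))

      Saturates-∷⁺ : ∀ {S} → Saturates (X ∖ a ∖ b) S → Saturates X ((a , b) ∷ S)
      Saturates-∷⁺ {S} = All.map λ {v} eq →
        trans (degreeIn-∷ a b S v)
              (trans (cong (indicator (does (v ≟ a) ∨ does (v ≟ b)) +_) eq) (sym (residual v)))

    count-∷ : ∀ L → length (filter (saturates? X ∘ ((a , b) ∷_)) L) ≡ ∂ᵉ (a , b) (count L) X
    count-∷ L = by-cases (X a) (X b) refl refl
      where
      ∂L = ∂ b (count L)
      by-cases : ∀ p q → X a ≡ p → X b ≡ q →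
                 length (filter (saturates? X ∘ ((a , b) ∷_)) L) ≡ ∂ a ∂L X
      by-cases false q Xa Xb = trans
        (cong length (Listₚ.filter-none (saturates? X ∘ ((a , b) ∷_)) (All.universal
          (λ S sat → 𝔹ₚ.not-¬ Xa (proj₁ (Saturates-∷-covered sat))) L)))
        (sym (∂-absent a ∂L X Xa))
      by-cases true false Xa Xb = trans
        (cong length (Listₚ.filter-none (saturates? X ∘ ((a , b) ∷_)) (All.universal
          (λ S sat → 𝔹ₚ.not-¬ Xb (proj₂ (Saturates-∷-covered sat))) L)))
        (sym (trans (∂-present a ∂L X Xa)
                    (∂-absent b (count L) (X ∖ a) (trans (∖-other X (a≢b ∘ sym)) Xb))))
      by-cases true true Xa Xb = trans
        (count-cong (saturates? X ∘ ((a , b) ∷_)) (Saturates-∷⁻ Xa Xb) (Saturates-∷⁺ Xa Xb) L)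
        (sym (trans (∂-present a ∂L X Xa)
                    (∂-present b (count L) (X ∖ a) (trans (∖-other X (a≢b ∘ sym)) Xb))))

  -- Sublists without and with the first edge match the two summands of `matchings`. Loops are
  -- excluded because a loop adds 1 to a degree, whereas `∂ᵉ` annihilates it.
  count-sublists : ∀ {E} → All (λ e → proj₁ e ≢ proj₂ e) E →
                   ∀ X → count (sublists E) X ≡ matchings E X
  count-sublists [] X = trans (length-filter-[-] (saturates? X) [])
    (cong (λ b → if b then 1 else 0)
          (does-⇔ (mk⇔ (All.map λ {v} → zero-indicator (X v))
                       (All.map λ Xv → cong indicator (sym Xv)))
                  (saturates? X []) (empty? X)))
    where
    zero-indicator : ∀ b → 0 ≡ indicator b → b ≡ false
    zero-indicator false _ = refl
  count-sublists {(a , b) ∷ E} (a≢b ∷ loopless) X = begin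
    count (L ++ map (e ∷_) L) X
      ≡⟨ cong length (Listₚ.filter-++ (saturates? X) L (map (e ∷_) L)) ⟩
    length (filter (saturates? X) L ++ filter (saturates? X) (map (e ∷_) L))
      ≡⟨ Listₚ.length-++ (filter (saturates? X) L) ⟩
    count L X + count (map (e ∷_) L) X
      ≡⟨ cong (count L X +_) (length-filter-map (saturates? X) (e ∷_) L) ⟩
    count L X + length (filter (saturates? X ∘ (e ∷_)) L)
      ≡⟨ cong (count L X +_) (count-∷ X a b a≢b L) ⟩
    count L X + ∂ᵉ e (count L) X
      ≡⟨ cong₂ _+_ (count-sublists loopless X) (∂ᵉ-cong e (count-sublists loopless) X) ⟩
    matchings E X + ∂ᵉ e (matchings E) X ∎
    where
    open ≡-Reasoning
    e = (a , b)
    L = sublists E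

  -- Cardinalities along a list of vertices.

  card : (V → Bool) → List V → ℕ
  card X []       = 0
  card X (v ∷ vs) = (if X v then 1 else 0) + card X vs

  card-∖-≤ : ∀ X u vs → card (X ∖ u) vs ≤ card X vs
  card-∖-≤ X u []       = z≤n
  card-∖-≤ X u (v ∷ vs) with X v | v ≟ u
  ... | true  | yes _ = ℕₚ.m≤n⇒m≤1+n (card-∖-≤ X u vs)
  ... | true  | no _  = s≤s (card-∖-≤ X u vs)
  ... | false | _     = card-∖-≤ X u vs

  card-∖-< : ∀ X u {vs} → X u ≡ true → u ∈ vs → card (X ∖ u) vs < card X vs
  card-∖-< X u {v ∷ vs} Xu (here refl)
    rewrite Xu | dec-true (u ≟ u) refl = s≤s (card-∖-≤ X u vs)
  card-∖-< X u {v ∷ vs} Xu (there u∈vs) with X v | v ≟ u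
  ... | true  | yes _ = ℕₚ.m≤n⇒m≤1+n (card-∖-< X u Xu u∈vs)
  ... | true  | no _  = s≤s (card-∖-< X u Xu u∈vs)
  ... | false | _     = card-∖-< X u Xu u∈vs

  card-∖-∉ : ∀ X u {vs} → All (_≢ u) vs → card (X ∖ u) vs ≡ card X vs
  card-∖-∉ X u []            = refl
  card-∖-∉ X u (v≢u ∷ vs≢u) =
    cong₂ _+_ (cong (λ b → if b then 1 else 0) (∖-other X v≢u)) (card-∖-∉ X u vs≢u)

  card-∖-unique : ∀ X u {vs} → Unique vs → card X vs ≤ suc (card (X ∖ u) vs)
  card-∖-unique X u {[]}     []         = z≤n
  card-∖-unique X u {v ∷ vs} (v∉ ∷ uniq) with v ≟ u
  ... | yes refl rewrite card-∖-∉ X v (All.map (_∘ sym) v∉) with X v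
  ...   | true  = ℕₚ.≤-refl
  ...   | false = ℕₚ.n≤1+n _
  card-∖-unique X u {v ∷ vs} (v∉ ∷ uniq) | no _ with X v
  ...   | true  = s≤s (card-∖-unique X u uniq)
  ...   | false = card-∖-unique X u uniq

  -- Starts the induction on `μ`: either the exponent is 0, or there is a fixed vertex to expand at.
  card-0 : ∀ X vs → (card X vs ≡ 0) ⊎ (∃ λ v → v ∈ vs × X v ≡ true)
  card-0 X []       = inj₁ refl
  card-0 X (v ∷ vs) with X v in Xv
  ... | true  = inj₂ (v , here refl , Xv)
  ... | false with card-0 X vs
  ...   | inj₁ ≡0              = inj₁ ≡0
  ...   | inj₂ (w , w∈vs , Xw) = inj₂ (w , there w∈vs , Xw)

  -- Matching numbers under an involution.

  module Symmetric
    (σ : V → V) (σ-involutive : ∀ v → σ (σ v) ≡ v)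
    (axis : List V) (axis-unique : Unique axis) (axis-fixed : All (λ v → σ v ≡ v) axis)
    (H : List (V × V)) where

    σᵉ : V × V → V × V
    σᵉ = ×-map σ σ

    -- H contains one edge of each σ-orbit {e, σe}.
    edges : List (V × V)
    edges = H ++ map σᵉ H

    σ-injective : ∀ {u v} → σ u ≡ σ v → u ≡ v
    σ-injective {u} {v} eq = trans (sym (σ-involutive u)) (trans (cong σ eq) (σ-involutive v))

    ∖-σ : ∀ X u → (X ∘ σ) ∖ u ≗ (X ∖ σ u) ∘ σ
    ∖-σ X u v = cong (λ b → X (σ v) ∧ not b)
      (does-⇔ (mk⇔ (cong σ) σ-injective) (v ≟ u) (σ v ≟ σ u))

    -- `Φ` and `Ψ` are kept separate because relabelling also changes the edge list.
    ∂-σ : ∀ u {Φ Ψ} → Extensional Φ → (∀ X → Φ (X ∘ σ) ≡ Ψ X) →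
          ∀ X → ∂ u Φ (X ∘ σ) ≡ ∂ (σ u) Ψ X
    ∂-σ u {Φ} Φ-ext Φσ≡Ψ X with X (σ u)
    ... | true  = trans (Φ-ext (∖-σ X u)) (Φσ≡Ψ (X ∖ σ u))
    ... | false = refl

    ∂ᵉ-σ : ∀ e {Φ Ψ} → Extensional Φ → (∀ X → Φ (X ∘ σ) ≡ Ψ X) →
           ∀ X → ∂ᵉ e Φ (X ∘ σ) ≡ ∂ᵉ (σᵉ e) Ψ X
    ∂ᵉ-σ (a , b) Φ-ext Φσ≡Ψ = ∂-σ a (∂-ext b Φ-ext) (∂-σ b Φ-ext Φσ≡Ψ)

    matchings-map-σ : ∀ E X → matchings E (X ∘ σ) ≡ matchings (map σᵉ E) X
    matchings-map-σ []      X = cong (λ b → if b then 1 else 0)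
      (does-⇔ (mk⇔ to from) (empty? (X ∘ σ)) (empty? X))
      where
      to : All (λ v → X (σ v) ≡ false) vertices → All (λ v → X v ≡ false) vertices
      to h = All.tabulate λ {v} _ →
        trans (cong X (sym (σ-involutive v))) (All.lookup h (complete (σ v)))
      from : All (λ v → X v ≡ false) vertices → All (λ v → X (σ v) ≡ false) vertices
      from h = All.tabulate λ {v} _ → All.lookup h (complete (σ v))
    matchings-map-σ (e ∷ E) X =
      cong₂ _+_ (matchings-map-σ E X) (∂ᵉ-σ e (matchings-ext E) (matchings-map-σ E) X)

    -- The involution exchanges the two halves of `edges`.
    edges-σ : map σᵉ edges ↭ edges
    edges-σ = ↭-trans (↭-reflexive eq) (Permₚ.++-comm (map σᵉ H) H)
      where
      open ≡-Reasoning
      eq : map σᵉ (H ++ map σᵉ H) ≡ map σᵉ H ++ H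
      eq = begin
        map σᵉ (H ++ map σᵉ H)            ≡⟨ Listₚ.map-++ σᵉ H (map σᵉ H) ⟩
        map σᵉ H ++ map σᵉ (map σᵉ H)     ≡⟨ cong (map σᵉ H ++_) (Listₚ.map-∘ H) ⟨
        map σᵉ H ++ map (σᵉ ∘ σᵉ) H       ≡⟨ cong (map σᵉ H ++_) (Listₚ.map-cong
                                              (λ (a , b) → cong₂ _,_ (σ-involutive a) (σ-involutive b)) H) ⟩
        map σᵉ H ++ map (λ e → e) H       ≡⟨ cong (map σᵉ H ++_) (Listₚ.map-id H) ⟩
        map σᵉ H ++ H                     ∎

    μ : Functional
    μ = matchings edges

    μ-ext : Extensional μ
    μ-ext = matchings-ext edges

    μ-σ : ∀ X → μ (X ∘ σ) ≡ μ X
    μ-σ X = trans (matchings-map-σ edges X) (matchings-↭ edges-σ X)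

    term-σ : ∀ v e X → σ v ≡ v → X ∘ σ ≗ X → term v (σᵉ e) μ X ≡ term v e μ X
    term-σ v (a , b) X σv≡v Xσ≗X = cong₂ (λ b n → if b then n else 0)
      (cong₂ _∨_ (inc a) (inc b))
      (trans (sym (∂ᵉ-σ (a , b) μ-ext μ-σ X)) (∂ᵉ-ext (a , b) μ-ext Xσ≗X))
      where
      inc : ∀ u → does (v ≟ σ u) ≡ does (v ≟ u)
      inc u = does-⇔ (mk⇔ (λ v≡σu → σ-injective (trans σv≡v v≡σu))
                          (λ v≡u → trans (sym σv≡v) (cong σ v≡u)))
                     (v ≟ σ u) (v ≟ u)

    expansion-σ : ∀ v E X → σ v ≡ v → X ∘ σ ≗ X →
                  expansion v (map σᵉ E) μ X ≡ expansion v E μ X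
    expansion-σ v []      X σv≡v Xσ≗X = refl
    expansion-σ v (e ∷ E) X σv≡v Xσ≗X =
      cong₂ _+_ (term-σ v e X σv≡v Xσ≗X) (expansion-σ v E X σv≡v Xσ≗X)

    -- The source of each factor 2: as `v` and `X` are invariant, the mirrored half of the edges
    -- contributes the same sum as `H`.
    μ-at-fixed : ∀ v X → σ v ≡ v → X ∘ σ ≗ X → X v ≡ true → μ X ≡ 2 * expansion v H μ X
    μ-at-fixed v X σv≡v Xσ≗X Xv = begin
      μ X                                              ≡⟨ matchings-expansion edges v X Xv ⟩
      expansion v edges μ X                            ≡⟨ expansion-++ v H (map σᵉ H) μ X ⟩
      expansion v H μ X + expansion v (map σᵉ H) μ X   ≡⟨ cong (expansion v H μ X +_) (expansion-σ v H X σv≡v Xσ≗X) ⟩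
      expansion v H μ X + expansion v H μ X            ≡⟨ cong (expansion v H μ X +_) (ℕₚ.+-identityʳ _) ⟨
      2 * expansion v H μ X                            ∎
      where open ≡-Reasoning

    ∖-fixed-symmetric : ∀ X v → σ v ≡ v → X ∘ σ ≗ X → (X ∖ v) ∘ σ ≗ X ∖ v
    ∖-fixed-symmetric X v σv≡v Xσ≗X w = begin
      (X ∖ v) (σ w)       ≡⟨ cong (λ u → (X ∖ u) (σ w)) σv≡v ⟨
      (X ∖ σ v) (σ w)     ≡⟨ ∖-σ X v w ⟨
      ((X ∘ σ) ∖ v) w     ≡⟨ ∖-cong v Xσ≗X w ⟩
      (X ∖ v) w           ∎
      where open ≡-Reasoning

    ∖-orbit-symmetric : ∀ X u → X ∘ σ ≗ X → (X ∖ u ∖ σ u) ∘ σ ≗ X ∖ u ∖ σ u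
    ∖-orbit-symmetric X u Xσ≗X w = begin
      (X ∖ u ∖ σ u) (σ w)         ≡⟨ ∖-σ (X ∖ u) u w ⟨
      (((X ∖ u) ∘ σ) ∖ u) w       ≡⟨ ∖-cong u (λ x → cong (λ z → (X ∖ z) (σ x)) (sym (σ-involutive u))) w ⟩
      (((X ∖ σ (σ u)) ∘ σ) ∖ u) w ≡⟨ ∖-cong u (∖-σ X (σ u)) w ⟨
      ((X ∘ σ) ∖ σ u ∖ u) w       ≡⟨ ∖-cong u (∖-cong (σ u) Xσ≗X) w ⟩
      (X ∖ σ u ∖ u) w             ≡⟨ ∖-comm X (σ u) u w ⟩
      (X ∖ u ∖ σ u) w             ∎
      where open ≡-Reasoning

    -- The simultaneous induction.

    axis-avoids : ∀ u → σ u ≢ u → All (_≢ u) axis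
    axis-avoids u σu≢u = All.map (λ σv≡v v≡u → σu≢u (subst (λ x → σ x ≡ x) v≡u σv≡v)) axis-fixed

    mutual
      -- The strict bound `s` on the size of `X` makes the mutual recursion structural.
      2^⌈axis/2⌉∣μ : ∀ s X → card X vertices < s → X ∘ σ ≗ X →
                     2 ^ ⌈ card X axis /2⌉ ∣ μ X
      2^⌈axis/2⌉∣μ (suc s) X (s≤s |X|≤s) Xσ≗X with card-0 X axis
      ... | inj₁ ≡0 rewrite ≡0 = 1∣ μ X
      ... | inj₂ (v , v∈axis , Xv) =
        -- `⌈ suc c /2⌉` computes to `suc ⌊ c /2⌋`: one factor 2 comes from the mirror pairs, the
        -- rest from the induction hypothesis for `∂ w μ`.
        ∣-trans (2^-mono-∣ (ℕₚ.⌈n/2⌉-mono (card-∖-unique X v axis-unique)))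
          (subst (2 * 2 ^ ⌊ card (X ∖ v) axis /2⌋ ∣_) (sym (μ-at-fixed v X σv≡v Xσ≗X Xv))
            (*-monoʳ-∣ 2 (expansion-∣ v H μ X μ-ext λ w →
              subst (2 ^ ⌊ card (X ∖ v) axis /2⌋ ∣_) (sym (∂-present v (∂ w μ) X Xv))
                (2^⌊axis/2⌋∣∂μ s (X ∖ v)
                  (ℕₚ.<-≤-trans (card-∖-< X v Xv (complete v)) |X|≤s)
                  (∖-fixed-symmetric X v σv≡v Xσ≗X) w))))
        where σv≡v = All.lookup axis-fixed v∈axis

      2^⌊axis/2⌋∣∂μ : ∀ s X → card X vertices < s → X ∘ σ ≗ X → ∀ u →
                      2 ^ ⌊ card X axis /2⌋ ∣ ∂ u μ X
      2^⌊axis/2⌋∣∂μ (suc s) X (s≤s |X|≤s) Xσ≗X u with X u in Xu | σ u ≟ u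
      ... | false | _ = _ ∣0
      ... | true | yes σu≡u =
        -- `⌊ suc c /2⌋` is by definition `⌈ c /2⌉`, so losing one axis vertex costs nothing here.
        ∣-trans (2^-mono-∣ (ℕₚ.⌊n/2⌋-mono (card-∖-unique X u axis-unique)))
          (2^⌈axis/2⌉∣μ s (X ∖ u)
            (ℕₚ.<-≤-trans (card-∖-< X u Xu (complete u)) |X|≤s)
            (∖-fixed-symmetric X u σu≡u Xσ≗X))
      ... | true | no σu≢u =
        -- Removing `σ u` too restores symmetry and leaves the axis untouched; its partner `w`
        -- becomes the new deleted vertex.
        subst (2 ^ ⌊ card X axis /2⌋ ∣_) (sym (matchings-expansion edges (σ u) (X ∖ u) X∖u[σu]))
          (expansion-∣ (σ u) edges μ (X ∖ u) μ-ext λ w →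
            subst (2 ^ ⌊ card X axis /2⌋ ∣_) (sym (∂-present (σ u) (∂ w μ) (X ∖ u) X∖u[σu]))
              (subst (λ n → 2 ^ ⌊ n /2⌋ ∣ ∂ w μ (X ∖ u ∖ σ u)) same-axis
                (2^⌊axis/2⌋∣∂μ s (X ∖ u ∖ σ u)
                  (ℕₚ.≤-<-trans (card-∖-≤ (X ∖ u) (σ u) vertices)
                    (ℕₚ.<-≤-trans (card-∖-< X u Xu (complete u)) |X|≤s))
                  (∖-orbit-symmetric X u Xσ≗X) w)))
        where
        X∖u[σu] : (X ∖ u) (σ u) ≡ true
        X∖u[σu] = trans (∖-other X σu≢u) (trans (Xσ≗X u) Xu)
        same-axis : card (X ∖ u ∖ σ u) axis ≡ card X axis
        same-axis = trans (card-∖-∉ (X ∖ u) (σ u) (axis-avoids (σ u) (σu≢u ∘ σ-injective)))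
                          (card-∖-∉ X u (axis-avoids u σu≢u))

-- Transposing cartesian products.

cartesianProduct-∷ʳ : ∀ {A B : Set} (xs : List A) (y : B) ys →
  cartesianProduct xs (y ∷ ys) ↭ map (_, y) xs ++ cartesianProduct xs ys
cartesianProduct-∷ʳ []       y ys = Perm.refl
cartesianProduct-∷ʳ (x ∷ xs) y ys = Perm.prep (x , y)
  (↭-trans (Permₚ.++⁺ˡ (map (x ,_) ys) (cartesianProduct-∷ʳ xs y ys))
           (Permₚ.shifts (map (x ,_) ys) (map (_, y) xs)))

map-swap-cartesianProduct : ∀ {A B : Set} (xs : List A) (ys : List B) →
  map ×-swap (cartesianProduct xs ys) ↭ cartesianProduct ys xs
map-swap-cartesianProduct []       ys = ↭-reflexive (sym (Listₚ.cartesianProductWith-zeroʳ _,_ ys))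
map-swap-cartesianProduct (x ∷ xs) ys = ↭-trans
  (↭-reflexive (trans (Listₚ.map-++ ×-swap (map (x ,_) ys) (cartesianProduct xs ys))
                      (cong (_++ map ×-swap (cartesianProduct xs ys)) (sym (Listₚ.map-∘ ys)))))
  (↭-trans (Permₚ.++⁺ˡ (map (_, x) ys) (map-swap-cartesianProduct xs ys))
           (↭-sym (cartesianProduct-∷ʳ ys x xs)))

-- The square grid and its transposition.

module Grid (m : ℕ) where

  n : ℕ
  n = suc m

  vertices : List (Vertex n)
  vertices = allVertices n

  complete : ∀ v → v ∈ vertices
  complete (i , j) = ∈-cartesianProduct⁺ (∈-allFin i) (∈-allFin j)

  open MatchingCounts (_≟V_ {n}) vertices complete

  full : Vertex n → Bool
  full _ = true

  required-indicator : ∀ h v → required h v ≡ indicator ((full ∖ h) v)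
  required-indicator h v with v ≟V h
  ... | yes _ = refl
  ... | no _  = refl

  horizontalEdge : Fin n × Fin m → Edge n
  horizontalEdge p = (proj₁ p , inject₁ (proj₂ p)) , (proj₁ p , fsuc (proj₂ p))

  verticalEdge : Fin m × Fin n → Edge n
  verticalEdge p = (inject₁ (proj₁ p) , proj₂ p) , (fsuc (proj₁ p) , proj₂ p)

  -- Plays the part of `H`: transposition turns horizontal edges into vertical ones, so each orbit
  -- has exactly one horizontal edge.
  horizontal : List (Edge n)
  horizontal = map horizontalEdge (cartesianProduct (allFin n) (allFin m))

  diagonal : List (Vertex n)
  diagonal = map (λ i → i , i) (allFin n)

  diagonal-unique : Unique diagonal
  diagonal-unique = Uniqueₚ.map⁺ (cong proj₁) (Uniqueₚ.allFin⁺ n)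

  diagonal-fixed : All (λ v → ×-swap v ≡ v) diagonal
  diagonal-fixed = Allₚ.map⁺ (All.tabulate λ _ → refl)

  open Symmetric ×-swap (λ _ → refl) diagonal diagonal-unique diagonal-fixed horizontal

  gridEdges↭edges : gridEdges n ↭ edges
  gridEdges↭edges = Permₚ.++⁺ˡ horizontal (↭-sym (↭-trans
    -- `σᵉ ∘ horizontalEdge` and `verticalEdge ∘ ×-swap` agree definitionally; only the order of
    -- enumeration remains to be adjusted.
    (↭-reflexive (trans (sym (Listₚ.map-∘ P)) (Listₚ.map-∘ P)))
    (Permₚ.map⁺ verticalEdge (map-swap-cartesianProduct (allFin n) (allFin m)))))
    where P = cartesianProduct (allFin n) (allFin m)

  inject₁≢suc : ∀ {l} (i : Fin l) → inject₁ i ≢ fsuc i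
  inject₁≢suc (fsuc i) eq = inject₁≢suc i (Finₚ.suc-injective eq)

  loopless : All (λ e → proj₁ e ≢ proj₂ e) (gridEdges n)
  loopless = Allₚ.++⁺
    (Allₚ.map⁺ {f = horizontalEdge} (All.universal
      (λ (i , j) eq → inject₁≢suc j (cong proj₂ eq)) (cartesianProduct (allFin n) (allFin m))))
    (Allₚ.map⁺ {f = verticalEdge} (All.universal
      (λ (i , j) eq → inject₁≢suc i (cong proj₁ eq)) (cartesianProduct (allFin m) (allFin n))))

  card-full : ∀ vs → card full vs ≡ length vs
  card-full []       = refl
  card-full (v ∷ vs) = cong suc (card-full vs)

  -- The hole is the deleted vertex: `∂ h μ full` computes to `μ` of the full set without `h`.
  a≡∂μ : ∀ h → a n h ≡ ∂ h μ full
  a≡∂μ h = begin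
    a n h
      ≡⟨ count-cong (isNearPerfectMatching? h)
           (All.map λ {v} eq → trans eq (required-indicator h v))
           (All.map λ {v} eq → trans eq (sym (required-indicator h v)))
           (sublists (gridEdges n)) ⟩
    count (sublists (gridEdges n)) (full ∖ h) ≡⟨ count-sublists loopless (full ∖ h) ⟩
    matchings (gridEdges n) (full ∖ h)        ≡⟨ matchings-↭ gridEdges↭edges (full ∖ h) ⟩
    μ (full ∖ h)                              ∎
    where open ≡-Reasoning

  card-diagonal : card full diagonal ≡ n
  card-diagonal = trans (card-full diagonal)
    (trans (Listₚ.length-map (λ i → i , i) (allFin n)) (Listₚ.length-tabulate {n = n} (λ i → i)))

  2^⌊n/2⌋∣a : ∀ h → 2 ^ ⌊ n /2⌋ ∣ a n h
  2^⌊n/2⌋∣a h = subst (2 ^ ⌊ n /2⌋ ∣_) (sym (a≡∂μ h))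
    (subst (λ l → 2 ^ ⌊ l /2⌋ ∣ ∂ h μ full) card-diagonal
      -- Reflexivity fixes the size bound as the successor of the number of vertices.
      (2^⌊axis/2⌋∣∂μ _ full ℕₚ.≤-refl (λ _ → refl) h))

theorem1 : (k : ℕ) (h : Vertex (suc (2 * k))) → 2 ^ k ∣ a (suc (2 * k)) h
-- `⌊ suc (2 * k) /2⌋` is `⌈ 2 * k /2⌉` by definition, so only the latter has to be evaluated.
theorem1 k h = subst (λ l → 2 ^ l ∣ a (suc (2 * k)) h) ⌈2k/2⌉≡k (Grid.2^⌊n/2⌋∣a (2 * k) h)
  where
  ⌈2k/2⌉≡k : ⌈ 2 * k /2⌉ ≡ k
  ⌈2k/2⌉≡k = trans (cong (λ l → ⌈ k + l /2⌉) (ℕₚ.+-identityʳ k)) (sym (ℕₚ.n≡⌈n+n/2⌉ k))
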